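{- Let $n\ge 2$, let $d\geq 0$ be an even integer, and let $C$ be an $n\times n$ circulant matrix with generator $(c_0,\ldots,c_{n-1})$ such that $c_0=d$, $c_j\in\{1,-1\}$ for $j=1,\ldots,n-1$, and $CC^T=(d^2+n-1)I$. Then $n=2(d+1)$.
   Context: A circulant matrix of order $n$ with generator $(c_0,c_1,\ldots,c_{n-1})$ is the $n\times n$ matrix whose entry in row $i$ and column $j$ (indices $0,\ldots,n-1$) is $c_{(j-i)\bmod n}$. -}

module Defs where

open import Data.Nat using (ℕ; zero; suc)
import Data.Nat as N
open import Data.Nat.DivMod using (_%_; m%n<n)
open import Data.Fin using (Fin; toℕ; fromℕ<; _≟_)
import Data.Fin as F
open import Data.Integer using (ℤ; _+_; _*_; 0ℤ)
open import Relation.Nullary using (yes; no)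

Σ : ∀ {n} → (Fin n → ℤ) → ℤ
Σ {zero}  f = 0ℤ
Σ {suc n} f = f F.zero + Σ (λ i → f (F.suc i))

subMod : ∀ {n} → Fin n → Fin n → Fin n
subMod {suc n} j i = fromℕ< (m%n<n (toℕ j N.+ (suc n N.∸ toℕ i)) (suc n))

Matrix : ℕ → Set
Matrix n = Fin n → Fin n → ℤ

circulant : ∀ {n} → (Fin n → ℤ) → Matrix n
circulant c i j = c (subMod j i)

transpose : ∀ {n} → Matrix n → Matrix n
transpose A i j = A j i

infixl 7 _·_
_·_ : ∀ {n} → Matrix n → Matrix n → Matrix n
(A · B) i k = Σ (λ j → A i j * B j k)

scalarI : ∀ {n} → ℤ → Matrix n
scalarI s i j with i ≟ j
... | yes _ = s
... | no _ = 0ℤ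

{-# OPTIONS --safe #-}
module Submission where

-- Extend c to an n-periodic f on ℕ. For odd x and y the product (x - 1)(y - 1) is 0 mod 4, so in
-- Σ_j (f j - 1)(f (j + t) - 1) only j = 0 and j = n - t count mod 4, while orthogonality makes the
-- sum independent of t. The two terms are even, hence n = 2m; the shift t = m makes the common value
-- 0 mod 4, and as d - 1 is odd this forces f t = f (n - t).
-- Put a i = f (2i) and b i = f (2i + 1). Orthogonality for the shift 2l + 1 and the symmetry of f give
-- Σ a i * b (i + l) = 0; the same argument mod 4 shows that b l does not depend on l, so Σ a i = 0.
-- For the shift 2l it now says Σ a i * a (i + l) = - m, where all terms are ≥ -1 except
-- two equal to d * a l. Hence d * a l ≤ -1 and a l = -1 for 0 < l < m, and Σ a i = 0 reads d = m - 1.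

open import Defs
open import Data.Nat using (ℕ; _≤_; _*_; _+_; _∸_; _^_)
open import Data.Nat.Divisibility using (_∣_)
open import Data.Fin using (Fin; toℕ)
open import Data.Integer using (ℤ; +_; -_; 1ℤ)
open import Data.Sum using (_⊎_)
open import Relation.Binary.PropositionalEquality using (_≡_)

import Data.Fin as Fin
open import Data.Fin using (fromℕ<)
open import Data.Fin.Properties using (toℕ-fromℕ<; fromℕ<-cong)
import Data.Integer as ℤ
open import Data.Integer using (0ℤ; -1ℤ)
  renaming (_+_ to _+ℤ_; _*_ to _*ℤ_; _-_ to _-ℤ_)
import Data.Integer.Properties as ℤ
open import Data.Integer.Divisibility.Signed using (divides; ∣⇒∣ᵤ; ∣m∣n⇒∣m+n; ∣m∣n⇒∣m-n; ∣m⇒∣-m)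
  renaming (_∣_ to _∣ℤ_)
open import Data.Integer.Tactic.RingSolver using (solve-∀)
open import Data.Nat using (zero; suc; _<_; z≤n; s≤s; NonZero; >-nonZero)
import Data.Nat.Divisibility as ℕ
open import Data.Nat.DivMod using (_%_; _/_; m%n<n; m≡m%n+[m/n]*n; m<n⇒m%n≡m; [m+n]%n≡m%n)
import Data.Nat.Properties as ℕ
import Data.Nat.Tactic.RingSolver as ℕ-Solver
open import Data.Sum using (inj₁; inj₂; [_,_]′)
open import Function using (_∘_; id)
open import Relation.Binary.Definitions using (tri<; tri≈; tri>)
open import Relation.Binary.PropositionalEquality
  using (_≢_; refl; sym; trans; cong; cong₂; subst; module ≡-Reasoning)
open import Relation.Nullary using (¬_; contradiction; yes; no)
open import Relation.Nullary.Decidable using (from-no)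

-- Finite sums of integer sequences

sum : ℕ → (ℕ → ℤ) → ℤ
sum n g = Σ {n} (λ i → g (toℕ i))

sum-cong : ∀ n {g h : ℕ → ℤ} → (∀ i → g i ≡ h i) → sum n g ≡ sum n h
sum-cong zero    eq = refl
sum-cong (suc n) eq = cong₂ _+ℤ_ (eq 0) (sum-cong n (eq ∘ suc))

sum-one : ∀ n → sum n (λ _ → 1ℤ) ≡ + n
sum-one zero    = refl
sum-one (suc n) = cong (1ℤ +ℤ_) (sum-one n)

sum-+ : ∀ n (g h : ℕ → ℤ) → sum n (λ i → g i +ℤ h i) ≡ sum n g +ℤ sum n h
sum-+ zero    g h = refl
sum-+ (suc n) g h = trans (cong (g 0 +ℤ h 0 +ℤ_) (sum-+ n (g ∘ suc) (h ∘ suc)))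
                          (interchange (g 0) (h 0) (sum n (g ∘ suc)) (sum n (h ∘ suc)))
  where
  interchange : ∀ x y z w → x +ℤ y +ℤ (z +ℤ w) ≡ x +ℤ z +ℤ (y +ℤ w)
  interchange = solve-∀

sum-*ʳ : ∀ n (g : ℕ → ℤ) k → sum n (λ i → g i *ℤ k) ≡ sum n g *ℤ k
sum-*ʳ zero    g k = refl
sum-*ʳ (suc n) g k = trans (cong (g 0 *ℤ k +ℤ_) (sum-*ʳ n (g ∘ suc) k))
                           (sym (ℤ.*-distribʳ-+ k (g 0) (sum n (g ∘ suc))))

sum-[g+1] : ∀ n (g : ℕ → ℤ) → sum n (λ i → g i +ℤ 1ℤ) ≡ sum n g +ℤ + n
sum-[g+1] n g = trans (sum-+ n g (λ _ → 1ℤ)) (cong (sum n g +ℤ_) (sum-one n))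

-- Expresses the sum examined mod 4 through the correlation of `g` and `h`, known from
-- orthogonality, and two plain sums, which a cyclic shift leaves unchanged.
sum-[g-1][h-1] : ∀ n (g h : ℕ → ℤ) →
  sum n (λ i → (g i -ℤ 1ℤ) *ℤ (h i -ℤ 1ℤ)) ≡ sum n (λ i → g i *ℤ h i) -ℤ sum n g -ℤ sum n h +ℤ + n
sum-[g-1][h-1] zero    g h = refl
sum-[g-1][h-1] (suc n) g h =
  trans (cong ((g 0 -ℤ 1ℤ) *ℤ (h 0 -ℤ 1ℤ) +ℤ_) (sum-[g-1][h-1] n (g ∘ suc) (h ∘ suc)))
        (expand (g 0) (h 0) (sum n (λ i → g (suc i) *ℤ h (suc i)))
                (sum n (g ∘ suc)) (sum n (h ∘ suc)) (+ n))
  where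
  expand : ∀ x y p s t k → (x -ℤ 1ℤ) *ℤ (y -ℤ 1ℤ) +ℤ (p -ℤ s -ℤ t +ℤ k)
                         ≡ x *ℤ y +ℤ p -ℤ (x +ℤ s) -ℤ (y +ℤ t) +ℤ (1ℤ +ℤ k)
  expand = solve-∀

sum-snoc : ∀ n (g : ℕ → ℤ) → sum (suc n) g ≡ sum n g +ℤ g n
sum-snoc zero    g = ℤ.+-comm (g 0) 0ℤ
sum-snoc (suc n) g = trans (cong (g 0 +ℤ_) (sum-snoc n (g ∘ suc)))
                           (sym (ℤ.+-assoc (g 0) (sum n (g ∘ suc)) (g (suc n))))

-- Relating the indices by `suc (i + j) ≡ n` avoids truncated subtraction. The induction matches the
-- first term of `g` with the last term of `h`.
sum-reflect : ∀ n {g h : ℕ → ℤ} → (∀ i j → suc (i + j) ≡ n → g i ≡ h j) → sum n g ≡ sum n h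
sum-reflect zero            eq = refl
sum-reflect (suc n) {g} {h} eq = begin
  g 0 +ℤ sum n (g ∘ suc)  ≡⟨ cong₂ _+ℤ_ (eq 0 n refl)
                                   (sum-reflect n (λ i j e → eq (suc i) j (cong suc e))) ⟩
  h n +ℤ sum n h          ≡⟨ ℤ.+-comm (h n) (sum n h) ⟩
  sum n h +ℤ h n          ≡⟨ sum-snoc n h ⟨
  sum (suc n) h           ∎
  where open ≡-Reasoning

sum-interleave : ∀ m (g : ℕ → ℤ) →
  sum (m * 2) g ≡ sum m (λ i → g (i * 2)) +ℤ sum m (λ i → g (suc (i * 2)))
sum-interleave zero    g = refl
sum-interleave (suc m) g =
  trans (cong (λ s → g 0 +ℤ (g 1 +ℤ s)) (sum-interleave m (g ∘ suc ∘ suc)))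
        (regroup (g 0) (g 1) (sum m (λ i → g (2 + i * 2))) (sum m (λ i → g (3 + i * 2))))
  where
  regroup : ∀ x y z w → x +ℤ (y +ℤ (z +ℤ w)) ≡ (x +ℤ z) +ℤ (y +ℤ w)
  regroup = solve-∀

-- Periodic sequences

Periodic : ℕ → (ℕ → ℤ) → Set
Periodic n g = ∀ i → g (i + n) ≡ g i

sum-rotate₁ : ∀ n {g : ℕ → ℤ} → g n ≡ g 0 → sum n (g ∘ suc) ≡ sum n g
sum-rotate₁ zero        eq = refl
sum-rotate₁ (suc n) {g} eq = begin
  sum (suc n) (g ∘ suc)            ≡⟨ sum-snoc n (g ∘ suc) ⟩
  sum n (g ∘ suc) +ℤ g (suc n)     ≡⟨ ℤ.+-comm (sum n (g ∘ suc)) (g (suc n)) ⟩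
  g (suc n) +ℤ sum n (g ∘ suc)     ≡⟨ cong (_+ℤ sum n (g ∘ suc)) eq ⟩
  sum (suc n) g                    ∎
  where open ≡-Reasoning

sum-rotate : ∀ n l {g : ℕ → ℤ} → Periodic n g → sum n (λ i → g (i + l)) ≡ sum n g
sum-rotate n zero    {g} per = sum-cong n (λ i → cong g (ℕ.+-identityʳ i))
sum-rotate n (suc l) {g} per = begin
  sum n (λ i → g (i + suc l))   ≡⟨ sum-cong n (λ i → cong g (ℕ.+-suc i l)) ⟩
  sum n (λ i → g (suc i + l))   ≡⟨ sum-rotate₁ n {λ i → g (i + l)} (trans (cong g (ℕ.+-comm n l)) (per l)) ⟩
  sum n (λ i → g (i + l))       ≡⟨ sum-rotate n l per ⟩
  sum n g                       ∎
  where open ≡-Reasoning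

periodic-* : ∀ {n} {g : ℕ → ℤ} → Periodic n g → ∀ k i → g (i + k * n) ≡ g i
periodic-*     {g = g} per zero    i = cong g (ℕ.+-identityʳ i)
periodic-* {n} {g = g} per (suc k) i =
  trans (cong g (sym (ℕ.+-assoc i n (k * n)))) (trans (periodic-* {g = g} per k (i + n)) (per i))

periodic-% : ∀ {n} .{{_ : NonZero n}} {g : ℕ → ℤ} → Periodic n g → ∀ i → g i ≡ g (i % n)
periodic-% {n} {g = g} per i =
  trans (cong g (m≡m%n+[m/n]*n i n)) (periodic-* {g = g} per (i / n) (i % n))

-- Sums with one or two exceptional terms

module AdditivelyClosed
  (P : ℤ → Set) (P-0 : P 0ℤ) (P-+ : ∀ {x y} → P x → P y → P (x +ℤ y)) where

  sum-closed : ∀ n {g : ℕ → ℤ} → (∀ i → i < n → P (g i)) → P (sum n g)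
  sum-closed zero    p = P-0
  sum-closed (suc n) p = P-+ (p 0 (s≤s z≤n)) (sum-closed n (λ i i<n → p (suc i) (s≤s i<n)))

  -- For divisibility by 4 this is a congruence, for nonnegativity a lower bound, for vanishing an
  -- equality.
  sum-except : ∀ n q {g : ℕ → ℤ} → q < n → (∀ i → i < n → i ≢ q → P (g i)) → P (sum n g -ℤ g q)
  sum-except (suc n) zero    {g} q<n p =
    subst P (cancel (g 0) (sum n (g ∘ suc))) (sum-closed n (λ i i<n → p (suc i) (s≤s i<n) (λ ())))
    where
    cancel : ∀ x s → s ≡ x +ℤ s -ℤ x
    cancel = solve-∀
  sum-except (suc n) (suc q) {g} (s≤s q<n) p =
    subst P (sym (ℤ.+-assoc (g 0) (sum n (g ∘ suc)) (- g (suc q))))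
      (P-+ (p 0 (s≤s z≤n) (λ ()))
           (sum-except n q q<n (λ i i<n i≢q → p (suc i) (s≤s i<n) (i≢q ∘ ℕ.suc-injective))))

  -- In a correlation with nonzero shift, the entry `d` occurs as a factor in exactly two terms: one
  -- at index 0, the other at some index `q > 0`.
  sum-except₀ : ∀ n q {g : ℕ → ℤ} → 0 < q → q < n → (∀ i → 0 < i → i < n → i ≢ q → P (g i)) →
                P (sum n g -ℤ (g 0 +ℤ g q))
  sum-except₀ (suc n) (suc q) {g} _ (s≤s q<n) p =
    subst P (cancel (g 0) (sum n (g ∘ suc)) (g (suc q)))
      (sum-except n q q<n (λ i i<n i≢q → p (suc i) (s≤s z≤n) (s≤s i<n) (i≢q ∘ ℕ.suc-injective)))
    where
    cancel : ∀ x s y → s -ℤ y ≡ x +ℤ s -ℤ (x +ℤ y)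
    cancel = solve-∀

module Mod4 = AdditivelyClosed (+ 4 ∣ℤ_) (divides 0ℤ refl) (λ {x} {y} → ∣m∣n⇒∣m+n {+ 4} {x} {y})
module NonNeg = AdditivelyClosed (0ℤ ℤ.≤_) ℤ.≤-refl ℤ.+-mono-≤
module Zero = AdditivelyClosed (_≡ 0ℤ) refl (cong₂ _+ℤ_)

-- Signs modulo 2 and 4

Sign : ℤ → Set
Sign x = (x ≡ 1ℤ) ⊎ (x ≡ -1ℤ)

2∣sign-1 : ∀ {x} → Sign x → + 2 ∣ℤ x -ℤ 1ℤ
2∣sign-1 (inj₁ refl) = divides 0ℤ refl
2∣sign-1 (inj₂ refl) = divides -1ℤ refl

4∣[sign-1][sign-1] : ∀ {x y} → Sign x → Sign y → + 4 ∣ℤ (x -ℤ 1ℤ) *ℤ (y -ℤ 1ℤ)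
4∣[sign-1][sign-1] {y = y} (inj₁ refl) _           = divides 0ℤ (ℤ.*-zeroˡ (y -ℤ 1ℤ))
4∣[sign-1][sign-1]         (inj₂ refl) (inj₁ refl) = divides 0ℤ refl
4∣[sign-1][sign-1]         (inj₂ refl) (inj₂ refl) = divides 1ℤ refl

0≤sign*sign+1 : ∀ {x y} → Sign x → Sign y → 0ℤ ℤ.≤ x *ℤ y +ℤ 1ℤ
0≤sign*sign+1 (inj₁ refl) (inj₁ refl) = ℤ.+≤+ z≤n
0≤sign*sign+1 (inj₁ refl) (inj₂ refl) = ℤ.+≤+ z≤n
0≤sign*sign+1 (inj₂ refl) (inj₁ refl) = ℤ.+≤+ z≤n
0≤sign*sign+1 (inj₂ refl) (inj₂ refl) = ℤ.+≤+ z≤n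

sign*sign : ∀ {x} → Sign x → x *ℤ x ≡ 1ℤ
sign*sign (inj₁ refl) = refl
sign*sign (inj₂ refl) = refl

-- For `d = 2e` the product is `4e - 2`, so 4 would divide 2.
4∤[even-1]*2 : ∀ {d} → 2 ∣ d → ¬ (+ 4 ∣ℤ (+ d -ℤ 1ℤ) *ℤ + 2)
4∤[even-1]*2 (ℕ.divides e refl) 4∣ =
  from-no (4 ℕ.∣? 2) (∣⇒∣ᵤ {+ 4} {+ 2} (subst (+ 4 ∣ℤ_) difference (∣m∣n⇒∣m-n (divides (+ e) refl) 4∣)))
  where
  rearrange : ∀ x → x *ℤ + 4 -ℤ (x *ℤ + 2 -ℤ 1ℤ) *ℤ + 2 ≡ + 2
  rearrange = solve-∀
  difference : + e *ℤ + 4 -ℤ (+ (e * 2) -ℤ 1ℤ) *ℤ + 2 ≡ + 2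
  difference = trans (cong (λ z → + e *ℤ + 4 -ℤ (z -ℤ 1ℤ) *ℤ + 2) (ℤ.pos-* e 2)) (rearrange (+ e))

-- Distinct signs differ by 2 or -2, and an odd number times either of these is not 0 mod 4.
sign-≡ : ∀ {d x y} → 2 ∣ d → Sign x → Sign y → + 4 ∣ℤ (+ d -ℤ 1ℤ) *ℤ (x -ℤ y) → x ≡ y
sign-≡     2∣d (inj₁ refl) (inj₁ refl) _  = refl
sign-≡     2∣d (inj₂ refl) (inj₂ refl) _  = refl
sign-≡     2∣d (inj₁ refl) (inj₂ refl) 4∣ = contradiction 4∣ (4∤[even-1]*2 2∣d)
sign-≡ {d} 2∣d (inj₂ refl) (inj₁ refl) 4∣ =
  contradiction (subst (+ 4 ∣ℤ_) (ℤ.neg-distribʳ-* (+ d -ℤ 1ℤ) (- + 2)) (∣m⇒∣-m 4∣))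
                (4∤[even-1]*2 2∣d)

-- Correlations of a generator modulo 4 and the parity of the order

record Generator (n d : ℕ) (f : ℕ → ℤ) : Set where
  field
    periodic   : Periodic n f
    origin     : f 0 ≡ + d
    sign       : ∀ j → 0 < j → j < n → Sign (f j)
    orthogonal : ∀ t → 0 < t → t < n → sum n (λ j → f j *ℤ f (j + t)) ≡ 0ℤ

module _ {n d f} (gen : Generator n d f) where
  open Generator gen

  -- Since `0 < i + t < 2n`, the shifted index is a multiple of `n` only when it equals `n`, that
  -- is, when `i` is `q`. Past `n`, one period is removed.
  sign-shift : ∀ i t q → q + t ≡ n → t < n → 0 < i → i < n → i ≢ q → Sign (f (i + t))
  sign-shift i t q q+t≡n t<n 0<i i<n i≢q with ℕ.<-cmp (i + t) n
  ... | tri< lt _ _ = sign (i + t) (ℕ.<-≤-trans 0<i (ℕ.m≤m+n i t)) lt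
  ... | tri≈ _ eq _ = contradiction (ℕ.+-cancelʳ-≡ t i q (trans eq (sym q+t≡n))) i≢q
  ... | tri> _ _ gt =
    subst Sign (trans (sym (periodic (i + t ∸ n))) (cong f (ℕ.m∸n+n≡m (ℕ.<⇒≤ gt))))
      (sign (i + t ∸ n) (ℕ.m<n⇒0<n∸m gt)
        (ℕ.+-cancelʳ-< n (i + t ∸ n) n
          (subst (_< n + n) (sym (ℕ.m∸n+n≡m (ℕ.<⇒≤ gt))) (ℕ.+-mono-< i<n t<n))))

  -- The first difference is the value of the sum of `(f i - 1)(f (i + t) - 1)`, computed from
  -- orthogonality. The subtracted products are its terms at `0` and `q`, where one factor is
  -- `d - 1`; all other terms are multiples of 4.
  correlation-mod4 : ∀ t q → 0 < t → 0 < q → q + t ≡ n →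
    + 4 ∣ℤ (+ n -ℤ (sum n f +ℤ sum n f))
           -ℤ ((+ d -ℤ 1ℤ) *ℤ (f t -ℤ 1ℤ) +ℤ (+ d -ℤ 1ℤ) *ℤ (f q -ℤ 1ℤ))
  correlation-mod4 t q 0<t 0<q q+t≡n = subst (+ 4 ∣ℤ_) (cong₂ _-ℤ_ total exceptional)
    (Mod4.sum-except₀ n q 0<q q<n
      (λ i 0<i i<n i≢q → 4∣[sign-1][sign-1] (sign i 0<i i<n)
                                            (sign-shift i t q q+t≡n t<n 0<i i<n i≢q)))
    where
    open ≡-Reasoning
    q<n : q < n
    q<n = subst (q <_) q+t≡n (ℕ.m<m+n q 0<t)
    t<n : t < n
    t<n = subst (t <_) q+t≡n (ℕ.m<n+m t 0<q)
    rearrange : ∀ s k → 0ℤ -ℤ s -ℤ s +ℤ k ≡ k -ℤ (s +ℤ s)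
    rearrange = solve-∀
    total : sum n (λ i → (f i -ℤ 1ℤ) *ℤ (f (i + t) -ℤ 1ℤ)) ≡ + n -ℤ (sum n f +ℤ sum n f)
    total = begin
      sum n (λ i → (f i -ℤ 1ℤ) *ℤ (f (i + t) -ℤ 1ℤ))
        ≡⟨ sum-[g-1][h-1] n f (λ i → f (i + t)) ⟩
      sum n (λ i → f i *ℤ f (i + t)) -ℤ sum n f -ℤ sum n (λ i → f (i + t)) +ℤ + n
        ≡⟨ cong₂ (λ x y → x -ℤ sum n f -ℤ y +ℤ + n) (orthogonal t 0<t t<n) (sum-rotate n t periodic) ⟩
      0ℤ -ℤ sum n f -ℤ sum n f +ℤ + n
        ≡⟨ rearrange (sum n f) (+ n) ⟩
      + n -ℤ (sum n f +ℤ sum n f) ∎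
    exceptional : (f 0 -ℤ 1ℤ) *ℤ (f t -ℤ 1ℤ) +ℤ (f q -ℤ 1ℤ) *ℤ (f (q + t) -ℤ 1ℤ)
                ≡ (+ d -ℤ 1ℤ) *ℤ (f t -ℤ 1ℤ) +ℤ (+ d -ℤ 1ℤ) *ℤ (f q -ℤ 1ℤ)
    exceptional = cong₂ _+ℤ_
      (cong (λ x → (x -ℤ 1ℤ) *ℤ (f t -ℤ 1ℤ)) origin)
      (trans (cong (λ x → (f q -ℤ 1ℤ) *ℤ (x -ℤ 1ℤ)) (trans (cong f q+t≡n) (trans (periodic 0) origin)))
             (ℤ.*-comm (f q -ℤ 1ℤ) (+ d -ℤ 1ℤ)))

  -- Take the shift 1, so `q` is `n - 1`. Modulo 2 the doubled sum vanishes, and so do the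
  -- exceptional terms, since a sign minus 1 is even.
  order-even : 2 ≤ n → 2 ∣ n
  order-even 2≤n = ∣⇒∣ᵤ {+ 2} {+ n}
    (2∣n (+ n) (sum n f) (+ d -ℤ 1ℤ) _ _
      (correlation-mod4 1 (n ∸ 1) (s≤s z≤n) 0<n∸1 n∸1+1≡n)
      (2∣sign-1 (sign 1 (s≤s z≤n) 2≤n))
      (2∣sign-1 (sign (n ∸ 1) 0<n∸1 n∸1<n)))
    where
    0<n∸1 : 0 < n ∸ 1
    0<n∸1 = ℕ.m<n⇒0<n∸m 2≤n
    n∸1+1≡n : n ∸ 1 + 1 ≡ n
    n∸1+1≡n = ℕ.m∸n+n≡m (ℕ.<⇒≤ 2≤n)
    n∸1<n : n ∸ 1 < n
    n∸1<n = subst (n ∸ 1 <_) n∸1+1≡n (ℕ.m<m+n (n ∸ 1) (s≤s z≤n))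
    split : ∀ k s e x y → k ≡ k -ℤ (s +ℤ s) -ℤ (e *ℤ x +ℤ e *ℤ y) +ℤ (s +ℤ s) +ℤ (e *ℤ x +ℤ e *ℤ y)
    split = solve-∀
    collect : ∀ w s e u v → w *ℤ + 4 +ℤ (s +ℤ s) +ℤ (e *ℤ (u *ℤ + 2) +ℤ e *ℤ (v *ℤ + 2))
                          ≡ (w *ℤ + 2 +ℤ s +ℤ e *ℤ u +ℤ e *ℤ v) *ℤ + 2
    collect = solve-∀
    2∣n : ∀ k s e x y → + 4 ∣ℤ (k -ℤ (s +ℤ s)) -ℤ (e *ℤ x +ℤ e *ℤ y) →
          + 2 ∣ℤ x → + 2 ∣ℤ y → + 2 ∣ℤ k
    2∣n k s e x y (divides w ew) (divides u refl) (divides v refl) =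
      divides (w *ℤ + 2 +ℤ s +ℤ e *ℤ u +ℤ e *ℤ v)
        (trans (split k s e x y)
          (trans (cong (λ z → z +ℤ (s +ℤ s) +ℤ (e *ℤ x +ℤ e *ℤ y)) ew) (collect w s e u v)))

-- Reflection symmetry of the generator

module _ {m d f} (2∣d : 2 ∣ d) (0<m : 0 < m) (gen : Generator (m * 2) d f) where
  open Generator gen

  n : ℕ
  n = m * 2

  m+m≡n : m + m ≡ n
  m+m≡n = double m
    where
    double : ∀ k → k + k ≡ k * 2
    double = ℕ-Solver.solve-∀

  m<n : m < n
  m<n = subst (m <_) m+m≡n (ℕ.m<m+n m 0<m)

  -- The shift by m pins down the residue mod 4 shared by all shifts.
  symmetric⁺ : ∀ t q → 0 < t → 0 < q → q + t ≡ n → f t ≡ f q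
  symmetric⁺ t q 0<t 0<q q+t≡n =
    sign-≡ 2∣d sign-t sign-q
      (compare (+ n -ℤ (sum n f +ℤ sum n f)) (+ d -ℤ 1ℤ) (f t) (f q) (f m)
               (correlation-mod4 gen m m 0<m 0<m m+m≡n)
               (correlation-mod4 gen t q 0<t 0<q q+t≡n)
               (2∣sign-1 (sign m 0<m m<n)) (2∣sign-1 sign-q))
    where
    sign-t : Sign (f t)
    sign-t = sign t 0<t (subst (t <_) q+t≡n (ℕ.m<n+m t 0<q))
    sign-q : Sign (f q)
    sign-q = sign q 0<q (subst (q <_) q+t≡n (ℕ.m<m+n q 0<t))
    -- The difference of the two congruences is `e` times `x + y - 2z`. Adding `e` times `2z - 2y`,
    -- a multiple of 4 because `y` and `z` are odd, leaves `e` times `x - y`.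
    rearrange : ∀ c e x y z → (c -ℤ (e *ℤ (z -ℤ 1ℤ) +ℤ e *ℤ (z -ℤ 1ℤ)))
                                -ℤ (c -ℤ (e *ℤ (x -ℤ 1ℤ) +ℤ e *ℤ (y -ℤ 1ℤ)))
                                +ℤ e *ℤ ((z -ℤ 1ℤ) +ℤ (z -ℤ 1ℤ) -ℤ ((y -ℤ 1ℤ) +ℤ (y -ℤ 1ℤ)))
                            ≡ e *ℤ (x -ℤ y)
    rearrange = solve-∀
    quadruple : ∀ e u v → e *ℤ (u *ℤ + 2 +ℤ u *ℤ + 2 -ℤ (v *ℤ + 2 +ℤ v *ℤ + 2)) ≡ e *ℤ (u -ℤ v) *ℤ + 4
    quadruple = solve-∀
    compare : ∀ c e x y z → + 4 ∣ℤ c -ℤ (e *ℤ (z -ℤ 1ℤ) +ℤ e *ℤ (z -ℤ 1ℤ)) →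
              + 4 ∣ℤ c -ℤ (e *ℤ (x -ℤ 1ℤ) +ℤ e *ℤ (y -ℤ 1ℤ)) →
              + 2 ∣ℤ z -ℤ 1ℤ → + 2 ∣ℤ y -ℤ 1ℤ → + 4 ∣ℤ e *ℤ (x -ℤ y)
    compare c e x y z 4∣₁ 4∣₂ (divides u eu) (divides v ev) =
      subst (+ 4 ∣ℤ_) (rearrange c e x y z)
        (∣m∣n⇒∣m+n (∣m∣n⇒∣m-n 4∣₁ 4∣₂)
          (divides (e *ℤ (u -ℤ v))
            (trans (cong₂ (λ p r → e *ℤ (p +ℤ p -ℤ (r +ℤ r))) eu ev) (quadruple e u v))))

  symmetric : ∀ i j → i + j ≡ n → f i ≡ f j
  symmetric zero    j       eq = trans (sym (periodic 0)) (cong f (sym eq))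
  symmetric (suc i) zero    eq =
    trans (cong f (trans (sym (ℕ.+-identityʳ (suc i))) eq)) (periodic 0)
  symmetric (suc i) (suc j) eq =
    symmetric⁺ (suc i) (suc j) (s≤s z≤n) (s≤s z≤n) (trans (ℕ.+-comm (suc j) (suc i)) eq)

  -- Shifted indices can pass `n`, so the symmetry is also needed about `n`. Here `j ≥ n`, and
  -- removing one period from `j` reduces to `symmetric`.
  symmetric₂-≤ : ∀ i j → i ≤ n → i + j ≡ n + n → f i ≡ f j
  symmetric₂-≤ i j i≤n eq = begin
    f i            ≡⟨ symmetric i (j ∸ n) (ℕ.+-cancelʳ-≡ n (i + (j ∸ n)) n sum-reduced) ⟩
    f (j ∸ n)      ≡⟨ periodic (j ∸ n) ⟨
    f (j ∸ n + n)  ≡⟨ cong f (ℕ.m∸n+n≡m n≤j) ⟩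
    f j            ∎
    where
    open ≡-Reasoning
    n≤j : n ≤ j
    n≤j = ℕ.+-cancelˡ-≤ n n j (subst (_≤ n + j) eq (ℕ.+-monoˡ-≤ j i≤n))
    sum-reduced : i + (j ∸ n) + n ≡ n + n
    sum-reduced = trans (ℕ.+-assoc i (j ∸ n) n) (trans (cong (λ k → i + k) (ℕ.m∸n+n≡m n≤j)) eq)

  symmetric₂ : ∀ i j → i + j ≡ n + n → f i ≡ f j
  symmetric₂ i j eq with ℕ.≤-total i n
  ... | inj₁ i≤n = symmetric₂-≤ i j i≤n eq
  ... | inj₂ n≤i = sym (symmetric₂-≤ j i j≤n (trans (ℕ.+-comm j i) eq))
    where
    j≤n : j ≤ n
    j≤n = ℕ.+-cancelˡ-≤ n j n (subst (n + j ≤_) eq (ℕ.+-monoˡ-≤ j n≤i))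

  -- Even-indexed and odd-indexed halves

  a b : ℕ → ℤ
  a i = f (i * 2)
  b i = f (suc (i * 2))

  a-periodic : Periodic m a
  a-periodic i = trans (cong f (ℕ.*-distribʳ-+ 2 i m)) (periodic (i * 2))

  b-periodic : Periodic m b
  b-periodic i = trans (cong (f ∘ suc) (ℕ.*-distribʳ-+ 2 i m)) (periodic (suc (i * 2)))

  a-sign : ∀ l → 0 < l → l < m → Sign (a l)
  a-sign l 0<l l<m = sign (l * 2) (ℕ.*-monoˡ-< 2 0<l) (ℕ.*-monoˡ-< 2 l<m)

  odd<n : ∀ {l} → l < m → suc (l * 2) < n
  odd<n l<m = ℕ.*-monoˡ-≤ 2 l<m

  -- Negating indices exchanges the even and the odd half of the correlation at an odd shift.
  odd-half≡even-half : ∀ l → l < m →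
    sum m (λ i → b i *ℤ f (suc (i * 2) + suc (l * 2))) ≡ sum m (λ i → a i *ℤ b (i + l))
  odd-half≡even-half l l<m = begin
    sum m (λ i → b i *ℤ f (suc (i * 2) + suc (l * 2)))
      -- Under `i = m - 1 - j` the index `2i + 1` reflects about `m` to `2j + 1`, and the shifted
      -- index reflects about `n` to the even index `2(j + l′)`.
      ≡⟨ sum-reflect m (λ i j eq → cong₂ _*ℤ_
           (symmetric (suc (i * 2)) (suc (j * 2)) (first i j eq))
           (symmetric₂ (suc (i * 2) + suc (l * 2)) ((j + l′) * 2) (second i j eq))) ⟩
    sum m (λ j → b j *ℤ a (j + l′))
      -- Rotating by `l` turns `j + l′` into `j + m`, where `a` has the value `a j`.
      ≡⟨ sum-rotate m l {λ j → b j *ℤ a (j + l′)} product-periodic ⟨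
    sum m (λ j → b (j + l) *ℤ a (j + l + l′))
      ≡⟨ sum-cong m (λ j → trans (ℤ.*-comm (b (j + l)) (a (j + l + l′)))
           (cong (_*ℤ b (j + l))
             (trans (cong a (trans (ℕ.+-assoc j l l′) (cong (λ k → j + k) l+l′≡m))) (a-periodic j)))) ⟩
    sum m (λ i → a i *ℤ b (i + l)) ∎
    where
    open ≡-Reasoning
    l′ : ℕ
    l′ = m ∸ l
    l+l′≡m : l + l′ ≡ m
    l+l′≡m = ℕ.m+[n∸m]≡n (ℕ.<⇒≤ l<m)
    product-periodic : Periodic m (λ j → b j *ℤ a (j + l′))
    product-periodic j = cong₂ _*ℤ_ (b-periodic j) (trans (cong a (swap j m l′)) (a-periodic (j + l′)))
      where
      swap : ∀ x y z → x + y + z ≡ x + z + y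
      swap = ℕ-Solver.solve-∀
    first : ∀ i j → suc (i + j) ≡ m → suc (i * 2) + suc (j * 2) ≡ n
    first i j eq = trans (double i j) (cong (_* 2) eq)
      where
      double : ∀ x y → suc (x * 2) + suc (y * 2) ≡ suc (x + y) * 2
      double = ℕ-Solver.solve-∀
    second : ∀ i j → suc (i + j) ≡ m → suc (i * 2) + suc (l * 2) + (j + l′) * 2 ≡ n + n
    second i j eq = trans (double i j l l′) (cong₂ (λ x y → x * 2 + y * 2) eq l+l′≡m)
      where
      double : ∀ x y z w → suc (x * 2) + suc (z * 2) + (y + w) * 2 ≡ suc (x + y) * 2 + (z + w) * 2
      double = ℕ-Solver.solve-∀

  -- The correlation of `f` at the odd shift `2l + 1` splits into two halves, both equal to this
  -- sum, so twice the sum is 0.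
  ab-orthogonal : ∀ l → l < m → sum m (λ i → a i *ℤ b (i + l)) ≡ 0ℤ
  ab-orthogonal l l<m = [ id , (λ ()) ]′ (ℤ.i*j≡0⇒i≡0∨j≡0 s {+ 2} (begin
    s *ℤ + 2 ≡⟨ double s ⟩
    s +ℤ s   ≡⟨ cong₂ _+ℤ_
                  (sum-cong m (λ i → cong (λ k → a i *ℤ f k) (shift i l)))
                  (sym (odd-half≡even-half l l<m)) ⟩
    sum m (λ i → a i *ℤ f (i * 2 + suc (l * 2))) +ℤ sum m (λ i → b i *ℤ f (suc (i * 2) + suc (l * 2)))
      ≡⟨ sum-interleave m (λ j → f j *ℤ f (j + suc (l * 2))) ⟨
    sum n (λ j → f j *ℤ f (j + suc (l * 2)))
      ≡⟨ orthogonal (suc (l * 2)) (s≤s z≤n) (odd<n l<m) ⟩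
    0ℤ ∎))
    where
    open ≡-Reasoning
    s : ℤ
    s = sum m (λ i → a i *ℤ b (i + l))
    double : ∀ x → x *ℤ + 2 ≡ x +ℤ x
    double = solve-∀
    shift : ∀ x y → suc ((x + y) * 2) ≡ x * 2 + suc (y * 2)
    shift = ℕ-Solver.solve-∀

  b-sign-< : ∀ l → l < m → Sign (b l)
  b-sign-< l l<m = sign (suc (l * 2)) (s≤s z≤n) (odd<n l<m)

  residue : ℕ → ℕ
  residue l = _%_ l m {{>-nonZero 0<m}}

  residue<m : ∀ l → residue l < m
  residue<m l = m%n<n l m {{>-nonZero 0<m}}

  b-residue : ∀ l → b l ≡ b (residue l)
  b-residue = periodic-% {{>-nonZero 0<m}} {g = b} b-periodic

  -- An odd index is never a multiple of the even period, so `b`, unlike `a`, never takes the value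
  -- from the origin.
  b-sign : ∀ l → Sign (b l)
  b-sign l = subst Sign (sym (b-residue l)) (b-sign-< (residue l) (residue<m l))

  -- As `b` consists of signs only, the single exceptional term is the one at `i = 0`, where `a` is
  -- `d`.
  ab-mod4 : ∀ l → l < m →
    + 4 ∣ℤ (0ℤ -ℤ sum m a -ℤ sum m b +ℤ + m) -ℤ (+ d -ℤ 1ℤ) *ℤ (b l -ℤ 1ℤ)
  ab-mod4 l l<m = subst (+ 4 ∣ℤ_)
    (cong₂ _-ℤ_
      (trans (sum-[g-1][h-1] m a (λ i → b (i + l)))
             (cong₂ (λ x y → x -ℤ sum m a -ℤ y +ℤ + m)
                    (ab-orthogonal l l<m) (sum-rotate m l {b} b-periodic)))
      (cong (λ x → (x -ℤ 1ℤ) *ℤ (b l -ℤ 1ℤ)) origin))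
    (Mod4.sum-except m 0 0<m
      (λ i i<m i≢0 → 4∣[sign-1][sign-1] (a-sign i (ℕ.n≢0⇒n>0 i≢0) i<m) (b-sign (i + l))))

  -- In `ab-mod4` only the last product depends on `l`. Comparing with `l = 0` makes
  -- `(d - 1)(b l - b 0)` a multiple of 4, which `sign-≡` turns into equality.
  b-constant : ∀ l → b l ≡ b 0
  b-constant l = trans (b-residue l)
    (sign-≡ 2∣d (b-sign (residue l)) (b-sign 0)
      (subst (+ 4 ∣ℤ_)
        (rearrange (0ℤ -ℤ sum m a -ℤ sum m b +ℤ + m) (+ d -ℤ 1ℤ) (b (residue l)) (b 0))
        (∣m∣n⇒∣m-n (ab-mod4 0 0<m) (ab-mod4 (residue l) (residue<m l)))))
    where
    rearrange : ∀ c e x y → (c -ℤ e *ℤ (y -ℤ 1ℤ)) -ℤ (c -ℤ e *ℤ (x -ℤ 1ℤ)) ≡ e *ℤ (x -ℤ y)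
    rearrange = solve-∀

  -- With `b` constant, orthogonality of `a` and `b` says that `sum m a` times a sign is 0;
  -- multiplying by that sign again removes it.
  sum-a≡0 : sum m a ≡ 0ℤ
  sum-a≡0 = begin
    sum m a                               ≡⟨ ℤ.*-identityʳ (sum m a) ⟨
    sum m a *ℤ 1ℤ                         ≡⟨ cong (sum m a *ℤ_) (sign*sign (b-sign 0)) ⟨
    sum m a *ℤ (b 0 *ℤ b 0)               ≡⟨ ℤ.*-assoc (sum m a) (b 0) (b 0) ⟨
    sum m a *ℤ b 0 *ℤ b 0                 ≡⟨ cong (_*ℤ b 0) (sum-*ʳ m a (b 0)) ⟨
    sum m (λ i → a i *ℤ b 0) *ℤ b 0       ≡⟨ cong (_*ℤ b 0)
                                               (sum-cong m (λ i → cong (a i *ℤ_) (b-constant (i + 0)))) ⟨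
    sum m (λ i → a i *ℤ b (i + 0)) *ℤ b 0 ≡⟨ cong (_*ℤ b 0) (ab-orthogonal 0 0<m) ⟩
    0ℤ                                    ∎
    where open ≡-Reasoning

  -- An even shift preserves the parity of indices, and the odd half contributes `m` because `b` is
  -- a constant sign.
  aa-correlation : ∀ l → 0 < l → l < m → sum m (λ i → a i *ℤ a (i + l)) +ℤ + m ≡ 0ℤ
  aa-correlation l 0<l l<m = begin
    sum m (λ i → a i *ℤ a (i + l)) +ℤ + m
      ≡⟨ cong₂ _+ℤ_
           (sum-cong m (λ i → cong (λ k → a i *ℤ f k) (ℕ.*-distribʳ-+ 2 i l)))
           (trans (sym (sum-one m)) (sum-cong m (λ i → sym (bb≡1 i)))) ⟩
    sum m (λ i → a i *ℤ f (i * 2 + l * 2)) +ℤ sum m (λ i → b i *ℤ f (suc (i * 2) + l * 2))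
      ≡⟨ sum-interleave m (λ j → f j *ℤ f (j + l * 2)) ⟨
    sum n (λ j → f j *ℤ f (j + l * 2))
      ≡⟨ orthogonal (l * 2) (ℕ.*-monoˡ-< 2 0<l) (ℕ.*-monoˡ-< 2 l<m) ⟩
    0ℤ ∎
    where
    open ≡-Reasoning
    bb≡1 : ∀ i → b i *ℤ f (suc (i * 2) + l * 2) ≡ 1ℤ
    bb≡1 i = trans
      (cong₂ _*ℤ_ (b-constant i)
        (trans (cong (f ∘ suc) (sym (ℕ.*-distribʳ-+ 2 i l))) (b-constant (i + l))))
      (sign*sign (b-sign 0))

  -- Add 1 to each term of the correlation of `a`: the total becomes 0, and the terms away from `0`
  -- and `q` are nonnegative. The two remaining terms, each `d * a l + 1`, thus have sum at most 0,
  -- which rules out `a l = 1`.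
  a≡-1 : ∀ l → 0 < l → l < m → a l ≡ -1ℤ
  a≡-1 l 0<l l<m = [ (λ al≡1 → contradiction (subst Bound al≡1 bound) impossible) , id ]′ (a-sign l 0<l l<m)
    where
    q : ℕ
    q = m ∸ l
    q+l≡m : q + l ≡ m
    q+l≡m = ℕ.m∸n+n≡m (ℕ.<⇒≤ l<m)
    0<q : 0 < q
    0<q = ℕ.m<n⇒0<n∸m l<m
    q<m : q < m
    q<m = subst (q <_) q+l≡m (ℕ.m<m+n q 0<l)
    aq≡al : a q ≡ a l
    aq≡al = symmetric (q * 2) (l * 2) (trans (sym (ℕ.*-distribʳ-+ 2 q l)) (cong (_* 2) q+l≡m))
    shifted-sign : ∀ i → 0 < i → i < m → i ≢ q → Sign (a (i + l))
    shifted-sign i 0<i i<m i≢q = subst (Sign ∘ f) (sym (ℕ.*-distribʳ-+ 2 i l))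
      (sign-shift gen (i * 2) (l * 2) (q * 2)
        (trans (sym (ℕ.*-distribʳ-+ 2 q l)) (cong (_* 2) q+l≡m))
        (ℕ.*-monoˡ-< 2 l<m) (ℕ.*-monoˡ-< 2 0<i) (ℕ.*-monoˡ-< 2 i<m)
        (i≢q ∘ ℕ.*-cancelʳ-≡ i q 2))
    Bound : ℤ → Set
    Bound x = 0ℤ ℤ.≤ 0ℤ -ℤ ((+ d *ℤ x +ℤ 1ℤ) +ℤ (x *ℤ + d +ℤ 1ℤ))
    bound : Bound (a l)
    bound = subst (0ℤ ℤ.≤_)
      (cong₂ _-ℤ_
        (trans (sum-[g+1] m (λ i → a i *ℤ a (i + l))) (aa-correlation l 0<l l<m))
        (cong₂ (λ x y → (x *ℤ a l +ℤ 1ℤ) +ℤ (y +ℤ 1ℤ)) origin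
          (cong₂ _*ℤ_ aq≡al (trans (cong a q+l≡m) (trans (a-periodic 0) origin)))))
      (NonNeg.sum-except₀ m q 0<q q<m
        (λ i 0<i i<m i≢q → 0≤sign*sign+1 (a-sign i 0<i i<m) (shifted-sign i 0<i i<m i≢q)))
    -- With 1 in front and `x = + d`, the right-hand side computes to a negative integer, so the
    -- absurd pattern applies.
    normalise : ∀ x → 0ℤ -ℤ ((x *ℤ 1ℤ +ℤ 1ℤ) +ℤ (1ℤ *ℤ x +ℤ 1ℤ)) ≡ 0ℤ -ℤ ((1ℤ +ℤ x) +ℤ (1ℤ +ℤ x))
    normalise = solve-∀
    impossible : ¬ Bound 1ℤ
    impossible 0≤ with () ← subst (0ℤ ℤ.≤_) (normalise (+ d)) 0≤

  half-order : m ≡ d + 1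
  half-order = ℤ.+-injective (begin
    + m                          ≡⟨ ℤ.+-identityˡ (+ m) ⟨
    0ℤ +ℤ + m                    ≡⟨ cong (_+ℤ + m) sum-a≡0 ⟨
    sum m a +ℤ + m               ≡⟨ sum-[g+1] m a ⟨
    -- Every term except that at `i = 0` is `-1 + 1`.
    sum m (λ i → a i +ℤ 1ℤ)      ≡⟨ ℤ.i-j≡0⇒i≡j _ _ (Zero.sum-except m 0 0<m
                                      (λ i i<m i≢0 → cong (_+ℤ 1ℤ) (a≡-1 i (ℕ.n≢0⇒n>0 i≢0) i<m))) ⟩
    a 0 +ℤ 1ℤ                    ≡⟨ cong (_+ℤ 1ℤ) origin ⟩
    + (d + 1)                    ∎)
    where open ≡-Reasoning

-- From the circulant matrix to its generator

generator-order : ∀ {n d f} → 2 ≤ n → 2 ∣ d → Generator n d f → n ≡ 2 * (d + 1)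
generator-order {d = d} 2≤n 2∣d gen with order-even gen 2≤n
... | ℕ.divides m refl =
  -- Weakening `2 ≤ m * 2` to `0 * 2 < m * 2` gives `0 < m`.
  trans (cong (_* 2) (half-order 2∣d (ℕ.*-cancelʳ-< 2 0 m (ℕ.<⇒≤ 2≤n)) gen)) (ℕ.*-comm (d + 1) 2)

scalarI-off-diagonal : ∀ {n} s {i j : Fin n} → i ≢ j → scalarI s i j ≡ 0ℤ
scalarI-off-diagonal s {i} {j} i≢j with i Fin.≟ j
... | yes i≡j = contradiction i≡j i≢j
... | no _    = refl

theorem3p8 : (n d : ℕ) → 2 ≤ n → 2 ∣ d → (c : Fin n → ℤ)
    → (∀ j → toℕ j ≡ 0 → c j ≡ + d)
    → (∀ j → 1 ≤ toℕ j → (c j ≡ 1ℤ) ⊎ (c j ≡ - 1ℤ))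
    → (∀ i k → (circulant c · transpose (circulant c)) i k ≡ scalarI (+ (d ^ 2 + n ∸ 1)) i k)
    → n ≡ 2 * (d + 1)
theorem3p8 n@(suc _) d 2≤n 2∣d c c-origin c-sign c-orthogonal =
  generator-order 2≤n 2∣d record
    { periodic   = periodic
    ; origin     = c-origin (fromℕ< (m%n<n 0 n)) refl
    ; sign       = λ j 0<j j<n → c-sign _
        (subst (0 <_) (sym (trans (toℕ-fromℕ< (m%n<n j n)) (m<n⇒m%n≡m j<n))) 0<j)
    ; orthogonal = orthogonal
    }
  where
  open ≡-Reasoning
  f : ℕ → ℤ
  f x = c (fromℕ< (m%n<n x n))
  periodic : Periodic n f
  periodic x = cong c (fromℕ<-cong _ _ ([m+n]%n≡m%n x n) (m%n<n (x + n) n) (m%n<n x n))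
  orthogonal : ∀ t → 0 < t → t < n → sum n (λ j → f j *ℤ f (j + t)) ≡ 0ℤ
  orthogonal t 0<t t<n = begin
    sum n (λ j → f j *ℤ f (j + t))
      -- At column `j`, row 0 reads `c` at `j + n` and row `k` reads it at `j + (n - k)`, both mod
      -- `n`. Hence `k = n - t` gives the shift `t`.
      ≡⟨ sum-cong n (λ j → cong₂ _*ℤ_ (sym (periodic j)) (cong (λ s → f (j + s)) (sym n∸k≡t))) ⟩
    sum n (λ j → f (j + n) *ℤ f (j + (n ∸ toℕ k)))
      ≡⟨ c-orthogonal Fin.zero k ⟩
    scalarI (+ (d ^ 2 + n ∸ 1)) Fin.zero k
      ≡⟨ scalarI-off-diagonal (+ (d ^ 2 + n ∸ 1)) 0≢k ⟩
    0ℤ ∎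
    where
    n∸t<n : n ∸ t < n
    n∸t<n = ℕ.∸-monoʳ-< 0<t (ℕ.<⇒≤ t<n)
    k : Fin n
    k = fromℕ< n∸t<n
    toℕ-k : toℕ k ≡ n ∸ t
    toℕ-k = toℕ-fromℕ< n∸t<n
    n∸k≡t : n ∸ toℕ k ≡ t
    n∸k≡t = trans (cong (n ∸_) toℕ-k) (ℕ.m∸[m∸n]≡n (ℕ.<⇒≤ t<n))
    0≢k : Fin.zero ≢ k
    0≢k eq = ℕ.<-irrefl (trans (cong toℕ eq) toℕ-k) (ℕ.m<n⇒0<n∸m t<n)
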